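{- For any fixed bipartite graph $G$ that is not a matching (i.e. $G$ has a vertex of degree at least 2), as $n\to\infty$, $$2^{n-1}+\left(\tfrac{1}{2}-o(1)\right)\binom{n}{\lfloor n/2\rfloor}\le \mathrm{vex}(n,G)\le 2^{n-1}+(1+o(1))\binom{n}{\lfloor n/2\rfloor}.$$
   Context: The Kneser cube $Kn_n$ is the graph with vertex set $2^{[n]}=\{F: F\subseteq\{1,\dots,n\}\}$ in which two distinct vertices $F,F'$ are adjacent if and only if $F\cap F'=\emptyset$. For a graph $G$, $\mathrm{vex}(n,G)$ is the maximum size of a family $\mathcal{F}\subseteq 2^{[n]}$ such that the induced subgraph $Kn_n[\mathcal{F}]$ contains no subgraph isomorphic to $G$. -}

module Defs where

open import Data.Nat using (ℕ; suc; _+_; _*_; _∸_; _^_; _≤_; _/_)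
open import Data.Nat.Combinatorics using (_C_)
open import Data.Fin using (Fin)
open import Data.Fin.Subset using (Subset; _∩_; ⊥)
open import Data.Bool using (Bool)
open import Data.List using (List; length)
open import Data.List.Membership.Propositional using (_∈_)
open import Data.List.Relation.Unary.Unique.Propositional using (Unique)
open import Data.Product using (Σ; ∃; _×_; _,_)
open import Relation.Binary.PropositionalEquality using (_≡_; _≢_)
open import Relation.Nullary using (¬_)
open import Function.Definitions using (Injective)

record Graph : Set₁ where
  field
    size  : ℕ
    Adj   : Fin size → Fin size → Set
    sym   : ∀ {i j} → Adj i j → Adj j i
    irrefl : ∀ {i} → ¬ Adj i i

open Graph public

Bipartite : Graph → Set
Bipartite G = Σ (Fin (size G) → Bool) λ c → ∀ i j → Adj G i j → c i ≢ c j

NotMatching : Graph → Set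
NotMatching G = ∃ λ v → ∃ λ a → ∃ λ b → a ≢ b × Adj G v a × Adj G v b

KnAdj : ∀ {n} → Subset n → Subset n → Set
KnAdj F F' = F ≢ F' × (F ∩ F' ≡ ⊥)

record Family (n : ℕ) : Set where
  constructor family
  field
    members : List (Subset n)
    unique  : Unique members

open Family public

ContainsCopy : ∀ {n} → Family n → Graph → Set
ContainsCopy {n} ℱ G =
  Σ (Fin (size G) → Subset n) λ φ →
    Injective _≡_ _≡_ φ × (∀ i → φ i ∈ members ℱ) × (∀ i j → Adj G i j → KnAdj (φ i) (φ j))

GFree : ∀ {n} → Family n → Graph → Set
GFree ℱ G = ¬ ContainsCopy ℱ G

VexAtLeast : ℕ → Graph → ℕ → Set
VexAtLeast n G v = Σ (Family n) λ ℱ → GFree ℱ G × v ≤ length (members ℱ)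

VexAtMost : ℕ → Graph → ℕ → Set
VexAtMost n G v = ∀ (ℱ : Family n) → GFree ℱ G → length (members ℱ) ≤ v

midBinom : ℕ → ℕ
midBinom n = n C (n / 2)

module Submission where

-- Lower bound: take the F ⊆ [n] with n ≤ 2 ∣F∣ + [1 ∈ F].  Two disjoint members have sizes adding
-- up to at least n, so each is the complement of the other: the family induces a matching.
--
-- Upper bound: call F central if F and ∁ F both lie in the family and neither is very small.  Up to a
-- negligible number, the family has at most 2^(n-1) + ½ #central members.  If F and ∁ F both had
-- s = ∣V(G)∣ central supersets, the complements of these would form a K_{s,s}.  So for every central
-- F, one of F and ∁ F is light, i.e. has at most s central supersets.  For light sets a LYM argument
-- works: a random maximal chain through a light F meets a further light set above F with probability
-- at most s / ∣∁ F∣, so there are at most (1 + o(1)) C(n, ⌊n/2⌋) of them.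

open import Defs hiding (sym)
open import Data.Bool using (Bool; true; false; if_then_else_)
import Data.Bool.Properties as Bool
open import Data.Fin using (Fin; zero; suc; inject≤)
import Data.Fin.Properties as Fin
open import Data.Fin.Subset using (Subset; inside; outside; ⊥; ∁; ∣_∣; _⊆_; _∩_)
open import Data.Fin.Subset.Properties
  using (∣∁p∣≡n∸∣p∣; ∣p∣≤n; out⊆; s⊆s; ⊆-refl; Empty-unique; x∈p∩q⁻; x∈∁p⇒x∉p; x∉p⇒x∈∁p; ∩-idem; ∩-comm; ∣⊥∣≡0)
open import Data.List using (List; []; _∷_; _++_; map; filter; length; lookup)
open import Data.List.Properties using (filter-++; length-++)
import Data.List.Membership.DecPropositional as DecMembership
open import Data.List.Membership.Propositional using (_∈_)
open import Data.List.Membership.Propositional.Properties using (∈-lookup; ∈-filter⁻; ∈-map⁻)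
open import Data.List.Relation.Unary.All as All using (All; []; _∷_)
import Data.List.Relation.Unary.All.Properties as All
open import Data.List.Relation.Unary.AllPairs using ([]; _∷_)
open import Data.List.Relation.Unary.Unique.Propositional using (Unique)
import Data.List.Relation.Unary.Unique.Propositional.Properties as Unique
open import Data.Nat
open import Data.Nat.Combinatorics
open import Data.Nat.DivMod using (m≡m%n+[m/n]*n; m%n<n; m/n*n≤m; m/n*n≡m; m/n<m; m*n/n≡m; /-monoˡ-≤)
open import Data.Nat.Properties
open import Data.Nat.Tactic.RingSolver using (solve-∀)
open import Data.Product using (_,_; _×_; ∃; proj₁; proj₂)
open import Data.Sum as Sum using (_⊎_; inj₁; inj₂)
open import Data.Vec using ([]; _∷_; head)
open import Data.Vec.Properties using (≡-dec; ∷-injectiveʳ)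
open import Function using (_∘_)
open import Function.Definitions using (Injective)
open import Relation.Binary.Definitions using (DecidableEquality)
open import Relation.Binary.PropositionalEquality
open import Relation.Nullary using (Dec; does; yes; no; ¬_; contradiction)
open import Relation.Nullary.Decidable using (_×-dec_)
open import Relation.Unary using (Decidable)

private variable n : ℕ

-- Binomial coefficients

nC0≡1 : ∀ n → n C 0 ≡ 1
nC0≡1 n = trans (nCk≡nC[n∸k] {0} {n} z≤n) (nCn≡1 n)

-- Subtraction-free form of (k+1) C(n,k+1) = (n-k) C(n,k), by induction through Pascal's rule.
C-absorption : ∀ n k → suc k * (n C suc k) + suc k * (n C k) ≡ suc n * (n C k)
C-absorption zero zero = refl
C-absorption zero (suc k)
  rewrite k>n⇒nCk≡0 {0} {suc k} z<s | k>n⇒nCk≡0 {0} {suc (suc k)} z<s | *-zeroʳ k = refl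
C-absorption (suc n) zero
  rewrite nC1≡n (suc n) | nC0≡1 (suc n) | *-identityʳ n | +-identityʳ n = cong suc (+-comm n 1)
C-absorption (suc n) (suc k)
  rewrite sym (nCk+nC[k+1]≡[n+1]C[k+1] n (suc k)) | sym (nCk+nC[k+1]≡[n+1]C[k+1] n k)
  = begin
  2+k * (b + c) + 2+k * (a + b)                     ≡⟨ regroup k a b c ⟩
  (2+k * c + 2+k * b) + (suc k * b + suc k * a) + (a + b) ≡⟨ cong₂ (λ x y → x + y + (a + b)) (C-absorption n (suc k)) (C-absorption n k) ⟩
  suc n * b + suc n * a + (a + b)                   ≡⟨ collect n a b ⟩
  suc (suc n) * (a + b)                             ∎
  where
  open ≡-Reasoning
  2+k = suc (suc k)
  a = n C k
  b = n C suc k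
  c = n C suc (suc k)
  regroup : ∀ k a b c → suc (suc k) * (b + c) + suc (suc k) * (a + b)
          ≡ (suc (suc k) * c + suc (suc k) * b) + (suc k * b + suc k * a) + (a + b)
  regroup = solve-∀
  collect : ∀ n a b → suc n * b + suc n * a + (a + b) ≡ suc (suc n) * (a + b)
  collect = solve-∀

-- By absorption, consecutive binomials have ratio (n-k)/(k+1), here at least M. The case M = 1
-- gives growth up to the middle; a large M makes the low layers negligible.
C-ratio : ∀ M n k → suc M * suc k ≤ suc n → M * (n C k) ≤ n C suc k
C-ratio M n k le = *-cancelˡ-≤ (suc k) (+-cancelʳ-≤ (suc k * a) _ _ (begin
  suc k * (M * a) + suc k * a ≡⟨ regroup M k a ⟩
  suc M * suc k * a           ≤⟨ *-monoˡ-≤ a le ⟩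
  suc n * a                   ≡⟨ C-absorption n k ⟨
  suc k * (n C suc k) + suc k * a ∎))
  where
  open ≤-Reasoning
  a = n C k
  regroup : ∀ M k a → suc k * (M * a) + suc k * a ≡ suc M * suc k * a
  regroup = solve-∀

C-increasing : ∀ n {j m} → j ≤′ m → 2 * m ≤ n → n C j ≤ n C m
C-increasing n ≤′-refl _ = ≤-refl
C-increasing n {j} {suc m} (≤′-step j≤m) 2m≤n = begin
  n C j       ≤⟨ C-increasing n j≤m (≤-trans (*-monoʳ-≤ 2 (n≤1+n m)) 2m≤n) ⟩
  n C m       ≡⟨ *-identityˡ (n C m) ⟨
  1 * (n C m) ≤⟨ C-ratio 1 n m (m≤n⇒m≤1+n 2m≤n) ⟩
  n C suc m   ∎
  where open ≤-Reasoning

n≤1+2*[n/2] : ∀ n → n ≤ suc (2 * (n / 2))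
n≤1+2*[n/2] n = begin
  n                 ≡⟨ m≡m%n+[m/n]*n n 2 ⟩
  n % 2 + n / 2 * 2 ≤⟨ +-mono-≤ (s≤s⁻¹ (m%n<n n 2)) (≤-reflexive (*-comm (n / 2) 2)) ⟩
  1 + 2 * (n / 2)   ∎
  where open ≤-Reasoning

2*[n/2]≤n : ∀ n → 2 * (n / 2) ≤ n
2*[n/2]≤n n = ≤-trans (≤-reflexive (*-comm 2 (n / 2))) (m/n*n≤m n 2)

C≤midBinom : ∀ n j → n C j ≤ midBinom n
C≤midBinom n j with j ≤? n / 2
... | yes j≤m = C-increasing n (≤⇒≤′ j≤m) (2*[n/2]≤n n)
... | no j≰m with j ≤? n
...   | no j≰n = ≤-trans (≤-reflexive (k>n⇒nCk≡0 (≰⇒> j≰n))) z≤n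
...   | yes j≤n = begin
  n C j       ≡⟨ nCk≡nC[n∸k] j≤n ⟩
  n C (n ∸ j) ≤⟨ C-increasing n (≤⇒≤′ (m≤n+o⇒m∸n≤o n j n≤j+m)) (2*[n/2]≤n n) ⟩
  n C m       ∎
  where
  open ≤-Reasoning
  m = n / 2
  n≤j+m : n ≤ j + m
  n≤j+m = begin
    n           ≤⟨ n≤1+2*[n/2] n ⟩
    suc (2 * m) ≡⟨ cong (λ x → suc (m + x)) (+-identityʳ m) ⟩
    suc m + m   ≤⟨ +-monoˡ-≤ m (≰⇒> j≰m) ⟩
    j + m       ∎

k![n∸k]!*nCk≡n! : ∀ {n k} → k ≤ n → k ! * (n ∸ k) ! * (n C k) ≡ n !
k![n∸k]!*nCk≡n! {n} {k} k≤n = begin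
  k ! * (n ∸ k) ! * (n C k)                   ≡⟨ cong (k ! * (n ∸ k) ! *_) (nCk≡n!/k![n-k]! k≤n) ⟩
  k ! * (n ∸ k) ! * (n ! / (k ! * (n ∸ k) !)) ≡⟨ *-comm (k ! * (n ∸ k) !) _ ⟩
  n ! / (k ! * (n ∸ k) !) * (k ! * (n ∸ k) !) ≡⟨ m/n*n≡m (k![n∸k]!∣n! k≤n) ⟩
  n !                                         ∎
  where
  open ≡-Reasoning
  instance
    _ = k !* (n ∸ k) !≢0

-- A k-set lies on k! c! maximal chains. The bound says that this is at least a 1/`midBinom n` share
-- of all n! chains, as LYM counting needs.
n!≤k!c!*midBinom : ∀ {k c n} → k + c ≡ n → n ! ≤ k ! * c ! * midBinom n
n!≤k!c!*midBinom {k} {c} refl = begin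
  (k + c) !                                  ≡⟨ k![n∸k]!*nCk≡n! (m≤m+n k c) ⟨
  k ! * (k + c ∸ k) ! * ((k + c) C k)        ≡⟨ cong (λ x → k ! * x ! * ((k + c) C k)) (m+n∸m≡n k c) ⟩
  k ! * c ! * ((k + c) C k)                  ≤⟨ *-monoʳ-≤ (k ! * c !) (C≤midBinom (k + c) k) ⟩
  k ! * c ! * midBinom (k + c)               ∎
  where open ≤-Reasoning

-- In an interval of rank a+b+2, an interior set of rank a+1 lies on (a+1)! (b+1)! maximal chains.
-- The extreme case is a set next to an end of the interval.
[1+a]![1+b]!≤[1+a+b]! : ∀ a b → suc a ! * suc b ! ≤ suc (a + b) !
[1+a]![1+b]!≤[1+a+b]! a zero rewrite +-identityʳ a = ≤-reflexive (*-identityʳ (suc a !))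
[1+a]![1+b]!≤[1+a+b]! a (suc b) = begin
  suc a ! * (suc (suc b) * suc b !) ≡⟨ swap (suc a !) (suc (suc b)) (suc b !) ⟩
  suc (suc b) * (suc a ! * suc b !) ≤⟨ *-mono-≤ (s≤s (m≤n+m (suc b) a)) ([1+a]![1+b]!≤[1+a+b]! a b) ⟩
  suc (a + suc b) * suc (a + b) !   ≡⟨ cong (λ x → suc (a + suc b) * x !) (+-suc a b) ⟨
  suc (a + suc b) !                 ∎
  where
  open ≤-Reasoning
  swap : ∀ x y z → x * (y * z) ≡ y * (x * z)
  swap = solve-∀

-- Sums over supersets

𝟙 : {P : Set} → Dec P → ℕ
𝟙 d = if does d then 1 else 0

𝟙-yes : {P : Set} (d : Dec P) → P → 1 ≤ 𝟙 d
𝟙-yes (yes _) _ = ≤-refl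
𝟙-yes (no ¬p) p = contradiction p ¬p

𝟙≤1 : {P : Set} (d : Dec P) → 𝟙 d ≤ 1
𝟙≤1 (yes _) = ≤-refl
𝟙≤1 (no _)  = z≤n

𝟙-mono : {P Q : Set} (d : Dec P) (e : Dec Q) → (P → Q) → 𝟙 d ≤ 𝟙 e
𝟙-mono (yes p) e f = 𝟙-yes e (f p)
𝟙-mono (no _)  e f = z≤n

𝟙-⊎ : {P Q R : Set} (d : Dec P) (e : Dec Q) (f : Dec R) → (P → Q ⊎ R) → 𝟙 d ≤ 𝟙 e + 𝟙 f
𝟙-⊎ (no _)  e f g = z≤n
𝟙-⊎ (yes p) e f g with g p
... | inj₁ q = ≤-trans (𝟙-yes e q) (m≤m+n _ _)
... | inj₂ r = ≤-trans (𝟙-yes f r) (m≤n+m _ _)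

𝟙+𝟙≤1+ : {P Q : Set} (d : Dec P) (e : Dec Q) {x : ℕ} → (P → Q → 1 ≤ x) → 𝟙 d + 𝟙 e ≤ 1 + x
𝟙+𝟙≤1+ (yes p) (yes q) f = s≤s (f p q)
𝟙+𝟙≤1+ (yes _) (no _)  f = m≤m+n 1 _
𝟙+𝟙≤1+ (no _)  e       f = ≤-trans (𝟙≤1 e) (m≤m+n 1 _)

-- upSum f F is the sum of f ∣ G ∖ F ∣ G over all supersets G of F.
upSum : (ℕ → Subset n → ℕ) → Subset n → ℕ
upSum f []            = f 0 []
upSum f (inside ∷ F)  = upSum (λ j G → f j (inside ∷ G)) F
upSum f (outside ∷ F) = upSum (λ j G → f (suc j) (inside ∷ G)) F + upSum (λ j G → f j (outside ∷ G)) F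

total : (Subset n → ℕ) → ℕ
total f = upSum (λ _ → f) ⊥

-- covers f F is the sum of f (F ∪ {x}) over all x ∉ F.
covers : (Subset n → ℕ) → Subset n → ℕ
covers f []            = 0
covers f (inside ∷ F)  = covers (f ∘ (inside ∷_)) F
covers f (outside ∷ F) = f (inside ∷ F) + covers (f ∘ (outside ∷_)) F

+-interchange : ∀ a b c d → (a + b) + (c + d) ≡ (a + c) + (b + d)
+-interchange = solve-∀

-- The equation on j hands the pointwise comparison the fact that j is the rank of G above F.
upSum-mono : {f g : ℕ → Subset n → ℕ} (F : Subset n) →
  (∀ j G → j + ∣ ∁ G ∣ ≡ ∣ ∁ F ∣ → f j G ≤ g j G) → upSum f F ≤ upSum g F
upSum-mono [] f≤g = f≤g 0 [] refl
upSum-mono (inside ∷ F) f≤g = upSum-mono F (λ j G → f≤g j (inside ∷ G))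
upSum-mono (outside ∷ F) f≤g = +-mono-≤
  (upSum-mono F (λ j G eq → f≤g (suc j) (inside ∷ G) (cong suc eq)))
  (upSum-mono F (λ j G eq → f≤g j (outside ∷ G) (trans (+-suc j _) (cong suc eq))))

upSum-cong : {f g : ℕ → Subset n → ℕ} (F : Subset n) →
  (∀ j G → f j G ≡ g j G) → upSum f F ≡ upSum g F
upSum-cong F f≡g = ≤-antisym
  (upSum-mono F (λ j G _ → ≤-reflexive (f≡g j G)))
  (upSum-mono F (λ j G _ → ≤-reflexive (sym (f≡g j G))))

upSum-+ : (f g : ℕ → Subset n → ℕ) (F : Subset n) →
  upSum (λ j G → f j G + g j G) F ≡ upSum f F + upSum g F
upSum-+ f g [] = refl
upSum-+ f g (inside ∷ F) = upSum-+ _ _ F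
upSum-+ f g (outside ∷ F)
  rewrite upSum-+ (λ j G → f (suc j) (inside ∷ G)) (λ j G → g (suc j) (inside ∷ G)) F
        | upSum-+ (λ j G → f j (outside ∷ G)) (λ j G → g j (outside ∷ G)) F
  = +-interchange (upSum (λ j G → f (suc j) (inside ∷ G)) F) _ _ _

upSum-* : (a : ℕ) (f : ℕ → Subset n → ℕ) (F : Subset n) →
  upSum (λ j G → a * f j G) F ≡ a * upSum f F
upSum-* a f [] = refl
upSum-* a f (inside ∷ F) = upSum-* a _ F
upSum-* a f (outside ∷ F)
  rewrite upSum-* a (λ j G → f (suc j) (inside ∷ G)) F
        | upSum-* a (λ j G → f j (outside ∷ G)) F
  = sym (*-distribˡ-+ a (upSum (λ j G → f (suc j) (inside ∷ G)) F) _)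

covers-mono : {f g : Subset n → ℕ} (F : Subset n) →
  (∀ G → suc ∣ ∁ G ∣ ≡ ∣ ∁ F ∣ → f G ≤ g G) → covers f F ≤ covers g F
covers-mono [] f≤g = z≤n
covers-mono (inside ∷ F) f≤g = covers-mono F (f≤g ∘ (inside ∷_))
covers-mono (outside ∷ F) f≤g =
  +-mono-≤ (f≤g (inside ∷ F) refl) (covers-mono F (λ G eq → f≤g (outside ∷ G) (cong suc eq)))

covers-+ : (f g : Subset n → ℕ) (F : Subset n) →
  covers (λ G → f G + g G) F ≡ covers f F + covers g F
covers-+ f g [] = refl
covers-+ f g (inside ∷ F) = covers-+ _ _ F
covers-+ f g (outside ∷ F) rewrite covers-+ (f ∘ (outside ∷_)) (g ∘ (outside ∷_)) F
  = +-interchange (f (inside ∷ F)) _ _ _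

covers-const : (a : ℕ) (F : Subset n) → covers (λ _ → a) F ≡ ∣ ∁ F ∣ * a
covers-const a [] = refl
covers-const a (inside ∷ F) = covers-const a F
covers-const a (outside ∷ F) = cong (a +_) (covers-const a F)

-- Each maximal chain of [F, ⊤] starts with exactly one cover of F. This is an equality except at
-- the full set, where the sum is empty while 0! = 1.
covers-! : (F : Subset n) → covers (λ G → ∣ ∁ G ∣ !) F ≤ ∣ ∁ F ∣ !
covers-! F with ∣ ∁ F ∣ in eq
... | zero  = ≤-trans (covers-mono F (λ G eq₁ → contradiction (trans eq₁ eq) λ ()))
                      (≤-trans (≤-reflexive (covers-const 0 F)) (≤-trans (≤-reflexive (*-zeroʳ ∣ ∁ F ∣)) z≤n))
... | suc c = begin
  covers (λ G → ∣ ∁ G ∣ !) F ≤⟨ covers-mono F (λ G eq₁ → ≤-reflexive (cong _! (suc-injective (trans eq₁ eq)))) ⟩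
  covers (λ _ → c !) F       ≡⟨ covers-const (c !) F ⟩
  ∣ ∁ F ∣ * c !              ≡⟨ cong (_* c !) eq ⟩
  suc c !                    ∎
  where open ≤-Reasoning

-- A set G ⊋ F lies above exactly ∣ G ∖ F ∣ of the covers of F.
covers-upSum : (u v : ℕ → ℕ) → (∀ j → u (suc j) ≡ suc j * v j) →
  (g : Subset n → ℕ) (F : Subset n) →
  u 0 * g F + covers (upSum (λ j G → v j * g G)) F ≡ upSum (λ j G → u j * g G) F
covers-upSum u v u≡ g [] = +-identityʳ _
covers-upSum u v u≡ g (inside ∷ F) = covers-upSum u v u≡ (g ∘ (inside ∷_)) F
covers-upSum {suc n} u v u≡ g (outside ∷ F) = begin
  u 0 * g₀ F + (V F + covers (λ G → V′ G + V₀ G) F)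
    ≡⟨ cong (λ x → u 0 * g₀ F + (V F + x)) (covers-+ V′ V₀ F) ⟩
  u 0 * g₀ F + (V F + (covers V′ F + covers V₀ F))
    ≡⟨ regroup (u 0 * g₀ F) (V F) (covers V′ F) (covers V₀ F) ⟩
  (V F + covers V′ F) + (u 0 * g₀ F + covers V₀ F)
    -- A superset counted by `g₁` adds the new element and j others. The cover by the new element
    -- contributes `v j`; the other j covers contribute `j * v j`, by induction with the shifted
    -- weights `v ∘ suc`.
    ≡⟨ cong₂ _+_ (cong (V F +_) (covers-upSum (λ j → j * v j) (v ∘ suc) (λ _ → refl) g₁ F))
                 (covers-upSum u v u≡ g₀ F) ⟩
  (V F + upSum (λ j G → j * v j * g₁ G) F) + upSum (λ j G → u j * g₀ G) F
    ≡⟨ cong (_+ upSum (λ j G → u j * g₀ G) F) (upSum-+ _ _ F) ⟨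
  upSum (λ j G → v j * g₁ G + j * v j * g₁ G) F + upSum (λ j G → u j * g₀ G) F
    ≡⟨ cong (_+ upSum (λ j G → u j * g₀ G) F) (upSum-cong F merge) ⟩
  upSum (λ j G → u (suc j) * g₁ G) F + upSum (λ j G → u j * g₀ G) F ∎
  where
  open ≡-Reasoning
  g₁ g₀ V V′ V₀ : Subset n → ℕ
  g₁ = g ∘ (inside ∷_)
  g₀ = g ∘ (outside ∷_)
  V  = upSum (λ j G → v j * g₁ G)
  V′ = upSum (λ j G → v (suc j) * g₁ G)
  V₀ = upSum (λ j G → v j * g₀ G)
  regroup : ∀ a b c d → a + (b + (c + d)) ≡ (b + c) + (a + d)
  regroup = solve-∀
  merge : ∀ j G → v j * g₁ G + j * v j * g₁ G ≡ u (suc j) * g₁ G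
  merge j G = trans (sym (*-distribʳ-+ (g₁ G) (v j) (j * v j))) (cong (_* g₁ G) (sym (u≡ j)))

-- Sums over the whole cube

total-+ : (f g : Subset n → ℕ) → total (λ G → f G + g G) ≡ total f + total g
total-+ f g = upSum-+ (λ _ → f) (λ _ → g) ⊥

total-mono : {f g : Subset n → ℕ} → (∀ G → f G ≤ g G) → total f ≤ total g
total-mono f≤g = upSum-mono ⊥ (λ _ G _ → f≤g G)

total-∁ : (f : Subset n → ℕ) → total (f ∘ ∁) ≡ total f
total-∁ {zero} f = refl
total-∁ {suc n} f
  rewrite total-∁ (f ∘ (inside ∷_)) | total-∁ (f ∘ (outside ∷_)) = +-comm (total (f ∘ (outside ∷_))) _

total-1 : ∀ n → total {n} (λ _ → 1) ≡ 2 ^ n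
total-1 zero = refl
total-1 (suc n) rewrite total-1 n = cong (2 ^ n +_) (sym (+-identityʳ _))

total-0 : ∀ n → total {n} (λ _ → 0) ≡ 0
total-0 zero = refl
total-0 (suc n) rewrite total-0 n = refl

total-layer : ∀ n j → total {n} (λ G → 𝟙 (∣ G ∣ ≟ j)) ≡ n C j
total-layer zero zero = refl
total-layer zero (suc j) = sym (k>n⇒nCk≡0 {0} {suc j} z<s)
total-layer (suc n) zero = begin
  total {n} (λ _ → 0) + total {n} (λ G → 𝟙 (∣ G ∣ ≟ 0)) ≡⟨ cong₂ _+_ (total-0 n) (total-layer n 0) ⟩
  n C 0     ≡⟨ nC0≡1 n ⟩
  1         ≡⟨ nC0≡1 (suc n) ⟨
  suc n C 0 ∎
  where open ≡-Reasoning
total-layer (suc n) (suc j) =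
  trans (cong₂ _+_ (total-layer n j) (total-layer n (suc j))) (nCk+nC[k+1]≡[n+1]C[k+1] n j)

∣∁⊥∣≡n : ∀ n → ∣ ∁ (⊥ {n}) ∣ ≡ n
∣∁⊥∣≡n zero = refl
∣∁⊥∣≡n (suc n) = cong suc (∣∁⊥∣≡n n)

∣p∣+∣∁p∣≡n : (p : Subset n) → ∣ p ∣ + ∣ ∁ p ∣ ≡ n
∣p∣+∣∁p∣≡n p = trans (cong (∣ p ∣ +_) (∣∁p∣≡n∸∣p∣ p)) (m+[n∸m]≡n (∣p∣≤n p))

-- A LYM inequality for families without large up-forks

module _ {P : Subset n → Set} (P? : Decidable P) where

  count : Subset n → ℕ
  count = upSum (λ _ G → 𝟙 (P? G))

  -- chains F sums, over the members G ⊇ F, the number of maximal chains of [F, ⊤] through G.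
  chains : Subset n → ℕ
  chains = upSum (λ j G → j ! * (𝟙 (P? G) * ∣ ∁ G ∣ !))

  -- Counts triples of a maximal chain of [F, ⊤] and two members G ⊊ H on it: `j !` ways from F to
  -- G, then `covers chains G` for the members strictly above G.
  excess : Subset n → ℕ
  excess = upSum (λ j G → j ! * (𝟙 (P? G) * covers chains G))

  -- A chain going up from F either stops at F or passes first through a cover of F.
  recursion : (g : Subset n → ℕ) (F : Subset n) →
    upSum (λ j G → j ! * g G) F ≡ g F + covers (upSum (λ j G → j ! * g G)) F
  recursion g F = trans (sym (covers-upSum _! _! (λ _ → refl) g F))
    (cong (_+ covers (upSum (λ j G → j ! * g G)) F) (*-identityˡ (g F)))

  -- If F is a member, its own term in `excess F` is all of `covers chains F` and pays for every
  -- further member. Otherwise the claim passes down from the covers of F.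
  chains≤!+excess-step : (F : Subset n) →
    (∀ G → suc ∣ ∁ G ∣ ≡ ∣ ∁ F ∣ → chains G ≤ ∣ ∁ G ∣ ! + excess G) →
    chains F ≤ ∣ ∁ F ∣ ! + excess F
  chains≤!+excess-step F ih with recursion (λ G → 𝟙 (P? G) * ∣ ∁ G ∣ !) F
                               | recursion (λ G → 𝟙 (P? G) * covers chains G) F
  ... | eq | eq′ with P? F
  ...   | yes _ = begin
    chains F                                            ≡⟨ eq ⟩
    1 * ∣ ∁ F ∣ ! + covers chains F                     ≡⟨ cong (_+ covers chains F) (*-identityˡ (∣ ∁ F ∣ !)) ⟩
    ∣ ∁ F ∣ ! + covers chains F                         ≡⟨ cong (∣ ∁ F ∣ ! +_) (*-identityˡ (covers chains F)) ⟨
    ∣ ∁ F ∣ ! + 1 * covers chains F                     ≤⟨ +-monoʳ-≤ (∣ ∁ F ∣ !) (m≤m+n _ _) ⟩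
    ∣ ∁ F ∣ ! + (1 * covers chains F + covers excess F) ≡⟨ cong (∣ ∁ F ∣ ! +_) eq′ ⟨
    ∣ ∁ F ∣ ! + excess F                                ∎
    where open ≤-Reasoning
  ...   | no _ = begin
    chains F                                       ≡⟨ eq ⟩
    covers chains F                                ≤⟨ covers-mono F ih ⟩
    covers (λ G → ∣ ∁ G ∣ ! + excess G) F          ≡⟨ covers-+ (λ G → ∣ ∁ G ∣ !) excess F ⟩
    covers (λ G → ∣ ∁ G ∣ !) F + covers excess F   ≤⟨ +-monoˡ-≤ _ (covers-! F) ⟩
    ∣ ∁ F ∣ ! + covers excess F                    ≡⟨ cong (∣ ∁ F ∣ ! +_) eq′ ⟨
    ∣ ∁ F ∣ ! + excess F                           ∎
    where open ≤-Reasoning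

  -- Summed over maximal chains, this is x ≤ 1 + x(x-1)/2 for the number x of members on a chain.
  chains≤!+excess : ∀ F → chains F ≤ ∣ ∁ F ∣ ! + excess F
  chains≤!+excess F = go ∣ ∁ F ∣ F refl
    where
    go : ∀ c F → ∣ ∁ F ∣ ≡ c → chains F ≤ ∣ ∁ F ∣ ! + excess F
    go zero    F eq = chains≤!+excess-step F (λ G eq₁ → contradiction (trans eq₁ eq) λ ())
    go (suc c) F eq = chains≤!+excess-step F (λ G eq₁ → go c G (suc-injective (trans eq₁ eq)))

  -- Of the (c+1)! maximal chains of [F, ⊤], at most c! pass through any given member strictly
  -- between F and ⊤.
  covers-chains≤ : (∀ G → P G → 1 ≤ ∣ ∁ G ∣) → ∀ {c} F → ∣ ∁ F ∣ ≡ suc c →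
    covers chains F ≤ c ! * count F
  covers-chains≤ P≢⊤ {c} F ∣∁F∣≡ = begin
    covers chains F                                             ≡⟨ covers-upSum u _! (λ _ → refl) (λ G → 𝟙 (P? G) * ∣ ∁ G ∣ !) F ⟩
    upSum (λ j G → u j * (𝟙 (P? G) * ∣ ∁ G ∣ !)) F              ≤⟨ upSum-mono F pointwise ⟩
    upSum (λ j G → c ! * 𝟙 (P? G)) F                            ≡⟨ upSum-* (c !) (λ _ G → 𝟙 (P? G)) F ⟩
    c ! * count F                                               ∎
    where
    open ≤-Reasoning
    -- The factorial, but with value 0 at 0, so that G = F drops out of the sum.
    u : ℕ → ℕ
    u zero    = 0
    u (suc j) = suc j * j !
    pointwise : ∀ j G → j + ∣ ∁ G ∣ ≡ ∣ ∁ F ∣ → u j * (𝟙 (P? G) * ∣ ∁ G ∣ !) ≤ c ! * 𝟙 (P? G)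
    pointwise zero G _ = z≤n
    pointwise (suc j) G eq with P? G
    ... | no _ = ≤-reflexive (trans (*-zeroʳ (suc j !)) (sym (*-zeroʳ (c !))))
    ... | yes p with ∣ ∁ G ∣ | P≢⊤ G p
    ...   | suc b | _ = begin
      suc j ! * (1 * suc b !) ≡⟨ cong (suc j ! *_) (*-identityˡ (suc b !)) ⟩
      suc j ! * suc b !       ≤⟨ [1+a]![1+b]!≤[1+a+b]! j b ⟩
      suc (j + b) !           ≡⟨ cong _! (trans (sym (+-suc j b)) (suc-injective (trans eq ∣∁F∣≡))) ⟩
      c !                     ≡⟨ *-identityʳ (c !) ⟨
      c ! * 1                 ∎

  module _ {s t : ℕ} (0<s : 0 < s)
    (P⇒small : ∀ G → P G → s + t ≤ ∣ ∁ G ∣) (P⇒count≤ : ∀ G → P G → count G ≤ s) where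

    -- There are at most s members above G, each on at most a 1/∣ ∁ G ∣ share of the chains going up
    -- from G. A random such chain thus meets on average at most s/(s+t) further members.
    excess-pointwise : ∀ G → P G → (s + t) * covers chains G ≤ s * ∣ ∁ G ∣ !
    excess-pointwise G p with ∣ ∁ G ∣ in eq | P⇒small G p
    ... | zero  | s+t≤0 = contradiction (≤-trans 0<s (≤-trans (m≤m+n s t) s+t≤0)) λ ()
    ... | suc c | s+t≤c = begin
      (s + t) * covers chains G ≤⟨ *-mono-≤ s+t≤c (covers-chains≤ (λ H q → ≤-trans 0<s (≤-trans (m≤m+n s t) (P⇒small H q))) G eq) ⟩
      suc c * (c ! * count G)   ≤⟨ *-monoʳ-≤ (suc c) (*-monoʳ-≤ (c !) (P⇒count≤ G p)) ⟩
      suc c * (c ! * s)         ≡⟨ regroup (suc c) (c !) s ⟩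
      s * suc c !               ∎
      where
      open ≤-Reasoning
      regroup : ∀ x y z → x * (y * z) ≡ z * (x * y)
      regroup = solve-∀

    excess≤chains : ∀ F → (s + t) * excess F ≤ s * chains F
    excess≤chains F = begin
      (s + t) * excess F                                                         ≡⟨ upSum-* (s + t) _ F ⟨
      upSum (λ j G → (s + t) * (j ! * (𝟙 (P? G) * covers chains G))) F           ≤⟨ upSum-mono F (λ j G _ → pointwise j G) ⟩
      upSum (λ j G → s * (j ! * (𝟙 (P? G) * ∣ ∁ G ∣ !))) F                       ≡⟨ upSum-* s _ F ⟩
      s * chains F                                                               ∎
      where
      open ≤-Reasoning
      swap : ∀ x y z → x * (y * (1 * z)) ≡ y * (x * z)
      swap = solve-∀
      zeros : ∀ x y → x * (y * 0) ≡ 0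
      zeros = solve-∀
      pointwise : ∀ j G → (s + t) * (j ! * (𝟙 (P? G) * covers chains G)) ≤ s * (j ! * (𝟙 (P? G) * ∣ ∁ G ∣ !))
      pointwise j G with P? G
      ... | no _  = ≤-reflexive (trans (zeros (s + t) (j !)) (sym (zeros s (j !))))
      ... | yes p = begin
        (s + t) * (j ! * (1 * covers chains G)) ≡⟨ swap (s + t) (j !) _ ⟩
        j ! * ((s + t) * covers chains G)       ≤⟨ *-monoʳ-≤ (j !) (excess-pointwise G p) ⟩
        j ! * (s * ∣ ∁ G ∣ !)                   ≡⟨ swap s (j !) _ ⟨
        s * (j ! * (1 * ∣ ∁ G ∣ !))             ∎

    -- Since `excess` is at most s/(s+t) of `chains`, it can be absorbed on the left: a random
    -- maximal chain meets on average at most 1 + s/t members.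
    chains⊥≤ : t * chains ⊥ ≤ (s + t) * n !
    chains⊥≤ = +-cancelˡ-≤ (s * chains ⊥) _ _ (begin
      s * chains ⊥ + t * chains ⊥        ≡⟨ *-distribʳ-+ (chains ⊥) s t ⟨
      (s + t) * chains ⊥                 ≤⟨ *-monoʳ-≤ (s + t) (chains≤!+excess ⊥) ⟩
      (s + t) * (∣ ∁ (⊥ {n}) ∣ ! + excess ⊥) ≡⟨ *-distribˡ-+ (s + t) (∣ ∁ (⊥ {n}) ∣ !) (excess ⊥) ⟩
      (s + t) * ∣ ∁ (⊥ {n}) ∣ ! + (s + t) * excess ⊥ ≤⟨ +-mono-≤ (≤-reflexive (cong (λ x → (s + t) * x !) (∣∁⊥∣≡n n))) (excess≤chains ⊥) ⟩
      (s + t) * n ! + s * chains ⊥       ≡⟨ +-comm _ (s * chains ⊥) ⟩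
      s * chains ⊥ + (s + t) * n !       ∎)
      where open ≤-Reasoning

    n!*total≤chains⊥*midBinom : n ! * total (𝟙 ∘ P?) ≤ midBinom n * chains ⊥
    n!*total≤chains⊥*midBinom = begin
      n ! * total (𝟙 ∘ P?)                                                 ≡⟨ upSum-* (n !) (λ _ → 𝟙 ∘ P?) ⊥ ⟨
      upSum (λ _ G → n ! * 𝟙 (P? G)) ⊥                                     ≤⟨ upSum-mono ⊥ (λ j G eq → pointwise j G (trans eq (∣∁⊥∣≡n n))) ⟩
      upSum (λ j G → midBinom n * (j ! * (𝟙 (P? G) * ∣ ∁ G ∣ !))) ⊥        ≡⟨ upSum-* (midBinom n) _ (⊥ {n}) ⟩
      midBinom n * chains ⊥                                                ∎
      where
      open ≤-Reasoning
      regroup : ∀ x y z w → x * y * z * w ≡ z * (x * (w * y))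
      regroup = solve-∀
      pointwise : ∀ j G → j + ∣ ∁ G ∣ ≡ n → n ! * 𝟙 (P? G) ≤ midBinom n * (j ! * (𝟙 (P? G) * ∣ ∁ G ∣ !))
      pointwise j G eq = begin
        n ! * 𝟙 (P? G)                                  ≤⟨ *-monoˡ-≤ (𝟙 (P? G)) (n!≤k!c!*midBinom {j} {∣ ∁ G ∣} eq) ⟩
        j ! * ∣ ∁ G ∣ ! * midBinom n * 𝟙 (P? G)         ≡⟨ regroup (j !) (∣ ∁ G ∣ !) (midBinom n) (𝟙 (P? G)) ⟩
        midBinom n * (j ! * (𝟙 (P? G) * ∣ ∁ G ∣ !))     ∎

    -- Double counting of the pairs of a maximal chain and a member on it, divided by n!.
    fork-bound : t * total (𝟙 ∘ P?) ≤ (s + t) * midBinom n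
    fork-bound = *-cancelˡ-≤ (n !) {{n !≢0}} (begin
      n ! * (t * total (𝟙 ∘ P?))     ≡⟨ swap (n !) t _ ⟩
      t * (n ! * total (𝟙 ∘ P?))     ≤⟨ *-monoʳ-≤ t n!*total≤chains⊥*midBinom ⟩
      t * (midBinom n * chains ⊥)    ≡⟨ swap t (midBinom n) _ ⟩
      midBinom n * (t * chains ⊥)    ≤⟨ *-monoʳ-≤ (midBinom n) chains⊥≤ ⟩
      midBinom n * ((s + t) * n !)   ≡⟨ rotate (midBinom n) (s + t) (n !) ⟩
      n ! * ((s + t) * midBinom n)   ∎)
      where
      open ≤-Reasoning
      swap : ∀ x y z → x * (y * z) ≡ y * (x * z)
      swap = solve-∀
      rotate : ∀ x y z → x * (y * z) ≡ z * (y * x)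
      rotate = solve-∀

-- Supersets as a list

-- The recursion mirrors `upSum`, so a lower bound on `count` can be turned into that many distinct
-- sets. `supersets ⊥` serves as the whole cube.
supersets : Subset n → List (Subset n)
supersets []            = [] ∷ []
supersets (inside ∷ F)  = map (inside ∷_) (supersets F)
supersets (outside ∷ F) = map (inside ∷_) (supersets F) ++ map (outside ∷_) (supersets F)

supersets-⊆ : (F : Subset n) → All (F ⊆_) (supersets F)
supersets-⊆ []            = ⊆-refl ∷ []
supersets-⊆ (inside ∷ F)  = All.map⁺ (All.map s⊆s (supersets-⊆ F))
supersets-⊆ (outside ∷ F) =
  All.++⁺ (All.map⁺ (All.map out⊆ (supersets-⊆ F))) (All.map⁺ (All.map out⊆ (supersets-⊆ F)))

supersets-unique : (F : Subset n) → Unique (supersets F)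
supersets-unique []            = [] ∷ []
supersets-unique (inside ∷ F)  = Unique.map⁺ ∷-injectiveʳ (supersets-unique F)
supersets-unique (outside ∷ F) = Unique.++⁺
  (Unique.map⁺ ∷-injectiveʳ (supersets-unique F)) (Unique.map⁺ ∷-injectiveʳ (supersets-unique F))
  λ (p , q) → inside≢outside (∈-map⁻ (inside ∷_) p) (∈-map⁻ (outside ∷_) q)
  where
  inside≢outside : ∀ {G} → ∃ (λ H → H ∈ supersets F × G ≡ inside ∷ H) →
    ¬ ∃ (λ H → H ∈ supersets F × G ≡ outside ∷ H)
  inside≢outside (_ , _ , refl) (_ , _ , ())

length-filter-map : {A B : Set} {P : B → Set} (P? : Decidable P) (f : A → B) (xs : List A) →
  length (filter P? (map f xs)) ≡ length (filter (P? ∘ f) xs)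
length-filter-map P? f []       = refl
length-filter-map P? f (x ∷ xs) with does (P? (f x))
... | true  = cong suc (length-filter-map P? f xs)
... | false = length-filter-map P? f xs

length-filter-supersets : {P : Subset n → Set} (P? : Decidable P) (F : Subset n) →
  length (filter P? (supersets F)) ≡ count P? F
length-filter-supersets P? [] with does (P? [])
... | true  = refl
... | false = refl
length-filter-supersets P? (inside ∷ F) =
  trans (length-filter-map P? (inside ∷_) (supersets F)) (length-filter-supersets (P? ∘ (inside ∷_)) F)
length-filter-supersets P? (outside ∷ F) = begin
  length (filter P? (xs ++ ys))                      ≡⟨ cong length (filter-++ P? xs ys) ⟩
  length (filter P? xs ++ filter P? ys)              ≡⟨ length-++ (filter P? xs) ⟩
  length (filter P? xs) + length (filter P? ys)      ≡⟨ cong₂ _+_ (counted inside) (counted outside) ⟩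
  count P? (outside ∷ F)                             ∎
  where
  open ≡-Reasoning
  xs = map (inside ∷_) (supersets F)
  ys = map (outside ∷_) (supersets F)
  counted : ∀ b → length (filter P? (map (b ∷_) (supersets F))) ≡ count (P? ∘ (b ∷_)) F
  counted b = trans (length-filter-map P? (b ∷_) (supersets F)) (length-filter-supersets (P? ∘ (b ∷_)) F)

lookup-injective : {A : Set} {xs : List A} → Unique xs → ∀ {i j} → lookup xs i ≡ lookup xs j → i ≡ j
lookup-injective (_   ∷ _)  {zero}  {zero}  _  = refl
lookup-injective (x≢s ∷ _)  {zero}  {suc j} eq = contradiction eq (All.lookup x≢s (∈-lookup j))
lookup-injective (x≢s ∷ _)  {suc i} {zero}  eq = contradiction (sym eq) (All.lookup x≢s (∈-lookup i))
lookup-injective (_   ∷ us) {suc i} {suc j} eq = cong suc (lookup-injective us eq)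

select : {A : Set} {xs : List A} → Unique xs → ∀ {s} → s ≤ length xs →
  ∃ λ (f : Fin s → A) → Injective _≡_ _≡_ f × (∀ i → f i ∈ xs)
select {xs = xs} us s≤ =
  (λ i → lookup xs (inject≤ i s≤)) ,
  (λ eq → Fin.inject≤-injective s≤ s≤ _ _ (lookup-injective us eq)) ,
  (λ i → ∈-lookup (inject≤ i s≤))

select-supersets : {P : Subset n → Set} (P? : Decidable P) (F : Subset n) → ∀ {s} → s ≤ count P? F →
  ∃ λ (f : Fin s → Subset n) → Injective _≡_ _≡_ f × (∀ i → F ⊆ f i) × (∀ i → P (f i))
select-supersets P? F s≤
  with f , inj , f∈ ← select (Unique.filter⁺ P? (supersets-unique F))
                        (≤-trans s≤ (≤-reflexive (sym (length-filter-supersets P? F))))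
  = f , inj , (λ i → All.lookup (supersets-⊆ F) (proj₁ (∈-filter⁻ P? (f∈ i))))
            , (λ i → proj₂ (∈-filter⁻ P? {xs = supersets F} (f∈ i)))

∁-involutive : (F : Subset n) → ∁ (∁ F) ≡ F
∁-involutive []      = refl
∁-involutive (b ∷ F) = cong₂ _∷_ (Bool.not-involutive b) (∁-involutive F)

∁-injective : {F G : Subset n} → ∁ F ≡ ∁ G → F ≡ G
∁-injective {F = F} {G} eq = trans (sym (∁-involutive F)) (trans (cong ∁ eq) (∁-involutive G))

∁∩∁≡⊥ : {F A B : Subset n} → F ⊆ A → ∁ F ⊆ B → ∁ A ∩ ∁ B ≡ ⊥
∁∩∁≡⊥ {A = A} {B} F⊆A ∁F⊆B = Empty-unique λ (x , x∈) →
  let x∈∁A , x∈∁B = x∈p∩q⁻ (∁ A) (∁ B) x∈ in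
  x∈∁p⇒x∉p x∈∁B (∁F⊆B (x∉p⇒x∈∁p (x∈∁p⇒x∉p x∈∁A ∘ F⊆A)))

-- Upper bound

disjoint⇒KnAdj : {A B : Subset n} → 0 < ∣ A ∣ → A ∩ B ≡ ⊥ → KnAdj A B
disjoint⇒KnAdj {n} {A} 0<∣A∣ A∩B≡⊥ = A≢B , A∩B≡⊥
  where
  A≢B : A ≢ _
  A≢B refl = contradiction (trans (cong ∣_∣ (trans (sym (∩-idem A)) A∩B≡⊥)) (∣⊥∣≡0 n)) (<⇒≢ 0<∣A∣ ∘ sym)

-- With `size G` sets on each side no renumbering is required: vertex i goes to `A i` or `B i` by
-- its colour. The `≢` inside `KnAdj` keeps the images of the two colour classes apart.
completeBipartite⇒copy : (ℱ : Family n) (G : Graph) → Bipartite G → (A B : Fin (size G) → Subset n) →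
  Injective _≡_ _≡_ A → Injective _≡_ _≡_ B → (∀ i → A i ∈ members ℱ) → (∀ i → B i ∈ members ℱ) →
  (∀ i j → KnAdj (A i) (B j)) → ContainsCopy ℱ G
completeBipartite⇒copy ℱ G (c , proper) A B A-inj B-inj A∈ B∈ adj = φ , φ-inj , φ∈ , φ-adj
  where
  φ : Fin (size G) → Subset _
  φ i = if c i then A i else B i
  φ-inj : Injective _≡_ _≡_ φ
  φ-inj {i} {j} eq with c i | c j
  ... | true  | true  = A-inj eq
  ... | false | false = B-inj eq
  ... | true  | false = contradiction eq (proj₁ (adj i j))
  ... | false | true  = contradiction (sym eq) (proj₁ (adj j i))
  φ∈ : ∀ i → φ i ∈ members ℱ
  φ∈ i with c i
  ... | true  = A∈ i
  ... | false = B∈ i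
  φ-adj : ∀ i j → Adj G i j → KnAdj (φ i) (φ j)
  φ-adj i j e with c i | c j | proper i j e
  ... | true  | true  | ≢ = contradiction refl ≢
  ... | false | false | ≢ = contradiction refl ≢
  ... | true  | false | _ = adj i j
  ... | false | true  | _ with ≢ , disj ← adj j i = ≢ ∘ sym , trans (∩-comm (B i) (A j)) disj

_≟ₛ_ : DecidableEquality (Subset n)
_≟ₛ_ = ≡-dec Bool._≟_

_∈?_ : (F : Subset n) (xs : List (Subset n)) → Dec (F ∈ xs)
_∈?_ = DecMembership._∈?_ _≟ₛ_

total-singleton : (F : Subset n) → 1 ≤ total (λ G → 𝟙 (G ≟ₛ F))
total-singleton []            = ≤-refl
total-singleton (inside ∷ F)  = ≤-trans (total-singleton F) (≤-trans (total-mono λ G →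
  𝟙-mono (G ≟ₛ F) ((inside ∷ G) ≟ₛ (inside ∷ F)) (cong (inside ∷_))) (m≤m+n _ _))
total-singleton (outside ∷ F) = ≤-trans (total-singleton F) (≤-trans (total-mono λ G →
  𝟙-mono (G ≟ₛ F) ((outside ∷ G) ≟ₛ (outside ∷ F)) (cong (outside ∷_))) (m≤n+m _ _))

length≤total : {xs : List (Subset n)} → Unique xs → length xs ≤ total (λ G → 𝟙 (G ∈? xs))
length≤total [] = z≤n
length≤total {xs = x ∷ xs} (x∉xs ∷ us) = begin
  suc (length xs)                                       ≤⟨ +-mono-≤ (total-singleton x) (length≤total us) ⟩
  total (λ G → 𝟙 (G ≟ₛ x)) + total (λ G → 𝟙 (G ∈? xs)) ≡⟨ total-+ (λ G → 𝟙 (G ≟ₛ x)) (λ G → 𝟙 (G ∈? xs)) ⟨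
  total (λ G → 𝟙 (G ≟ₛ x) + 𝟙 (G ∈? xs))               ≤⟨ total-mono pointwise ⟩
  total (λ G → 𝟙 (G ∈? (x ∷ xs)))                       ∎
  where
  open ≤-Reasoning
  pointwise : ∀ G → 𝟙 (G ≟ₛ x) + 𝟙 (G ∈? xs) ≤ 𝟙 (G ∈? (x ∷ xs))
  pointwise G with G ≟ₛ x | G ∈? xs
  ... | yes refl | yes p = contradiction refl (All.lookup x∉xs p)
  ... | yes refl | no _  = ≤-refl
  ... | no _     | yes _ = ≤-refl
  ... | no _     | no _  = z≤n

-- By `C-ratio` each layer below L is at most 1/M of the next layer, hence at most `midBinom n` / M;
-- there are L such layers.
total-lowLayers : ∀ n M L → (M + 1) * L ≤ suc n →
  M * total {n} (λ G → 𝟙 (∣ G ∣ <? L)) ≤ L * midBinom n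
total-lowLayers n M zero _ = ≤-reflexive (trans (cong (M *_) (total-0 n)) (*-zeroʳ M))
total-lowLayers n M (suc L) le = begin
  M * total {n} (λ G → 𝟙 (∣ G ∣ <? suc L))   ≤⟨ *-monoʳ-≤ M (total-mono {n} split) ⟩
  M * total {n} (λ G → 𝟙 (∣ G ∣ ≟ L) + 𝟙 (∣ G ∣ <? L))
    ≡⟨ cong (M *_) (total-+ {n} (λ G → 𝟙 (∣ G ∣ ≟ L)) (λ G → 𝟙 (∣ G ∣ <? L))) ⟩
  M * (total {n} (λ G → 𝟙 (∣ G ∣ ≟ L)) + below)
    ≡⟨ cong (λ x → M * (x + below)) (total-layer n L) ⟩
  M * (n C L + below)                        ≡⟨ *-distribˡ-+ M (n C L) below ⟩
  M * (n C L) + M * below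
    ≤⟨ +-mono-≤ (≤-trans (C-ratio M n L (subst (λ x → x * suc L ≤ suc n) (+-comm M 1) le)) (C≤midBinom n (suc L)))
                (total-lowLayers n M L (≤-trans (*-monoʳ-≤ (M + 1) (n≤1+n L)) le)) ⟩
  midBinom n + L * midBinom n                ∎
  where
  open ≤-Reasoning
  below = total {n} (λ G → 𝟙 (∣ G ∣ <? L))
  split : ∀ G → 𝟙 (∣ G ∣ <? suc L) ≤ 𝟙 (∣ G ∣ ≟ L) + 𝟙 (∣ G ∣ <? L)
  split G = 𝟙-⊎ (∣ G ∣ <? suc L) (∣ G ∣ ≟ L) (∣ G ∣ <? L) (Sum.swap ∘ m≤n⇒m<n∨m≡n ∘ s≤s⁻¹)

module _ (ℱ : Family n) (G : Graph) (bip : Bipartite G) (free : GFree ℱ G) (0<s : 0 < size G) (t : ℕ) where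

  private
    s L : ℕ
    s = size G
    L = s + t
    0<L : 0 < L
    0<L = ≤-trans 0<s (m≤m+n s t)

  -- The size condition is symmetric, so being central passes to complements; its half about `∁ F`
  -- is the room above F that `fork-bound` requires.
  Central Light : Subset n → Set
  central? : Decidable Central
  Central F = (F ∈ members ℱ × ∁ F ∈ members ℱ) × (L ≤ ∣ F ∣ × L ≤ ∣ ∁ F ∣)
  central? F = ((F ∈? members ℱ) ×-dec (∁ F ∈? members ℱ)) ×-dec ((L ≤? ∣ F ∣) ×-dec (L ≤? ∣ ∁ F ∣))
  Light F = Central F × count central? F ≤ s

  light? : Decidable Light
  light? F = central? F ×-dec (count central? F ≤? s)

  central-∁ : ∀ {F} → Central F → Central (∁ F)
  central-∁ {F} ((F∈ , ∁F∈) , (L≤F , L≤∁F)) =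
    (∁F∈ , subst (_∈ members ℱ) (sym (∁-involutive F)) F∈) ,
    (L≤∁F , subst (λ H → L ≤ ∣ H ∣) (sym (∁-involutive F)) L≤F)

  light-or-∁-light : ∀ F → Central F → Light F ⊎ Light (∁ F)
  light-or-∁-light F cF with count central? F ≤? s | count central? (∁ F) ≤? s
  ... | yes c≤ | _      = inj₁ (cF , c≤)
  ... | no _   | yes c≤ = inj₂ (central-∁ cF , c≤)
  ... | no c≰  | no c≰′
    with A , A-inj , F⊆A , A-central ← select-supersets central? F (<⇒≤ (≰⇒> c≰))
       | B , B-inj , ∁F⊆B , B-central ← select-supersets central? (∁ F) (<⇒≤ (≰⇒> c≰′))
    = contradiction
        -- Complements of central sets are again in ℱ, and they are nonempty because L > 0, so
        -- disjointness makes them adjacent.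
        (completeBipartite⇒copy ℱ G bip (∁ ∘ A) (∁ ∘ B)
          (A-inj ∘ ∁-injective) (B-inj ∘ ∁-injective)
          (proj₂ ∘ proj₁ ∘ A-central) (proj₂ ∘ proj₁ ∘ B-central)
          (λ i j → disjoint⇒KnAdj (≤-trans 0<L (proj₂ (proj₂ (A-central i)))) (∁∩∁≡⊥ (F⊆A i) (∁F⊆B j))))
        free

  total-light : t * total (𝟙 ∘ light?) ≤ (s + t) * midBinom n
  total-light = fork-bound light? 0<s (λ F ((_ , (_ , L≤∁F)) , _) → L≤∁F)
    (λ F (_ , c≤) → ≤-trans (upSum-mono F (λ _ H _ → 𝟙-mono (light? H) (central? H) proj₁)) c≤)

  private
    low light : Subset n → ℕ
    low F = 𝟙 (∣ F ∣ <? L)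
    light = 𝟙 ∘ light?

  -- When F and `∁ F` are both in ℱ, either one has fewer than L elements, or F is central and one
  -- of the two is light. Summing over all F meets each pair twice, hence the factor 2 in
  -- `2*length≤`.
  complementary-pair : ∀ F → 𝟙 (F ∈? members ℱ) + 𝟙 (∁ F ∈? members ℱ) ≤
    1 + ((light F + light (∁ F)) + (low F + low (∁ F)))
  complementary-pair F = 𝟙+𝟙≤1+ (F ∈? members ℱ) (∁ F ∈? members ℱ) (λ F∈ ∁F∈ →
    cases (λ L≤F L≤∁F → light-or-∁-light F ((F∈ , ∁F∈) , (L≤F , L≤∁F))) (∣ F ∣ <? L) (∣ ∁ F ∣ <? L))
    where
    cases : (L ≤ ∣ F ∣ → L ≤ ∣ ∁ F ∣ → Light F ⊎ Light (∁ F)) → Dec (∣ F ∣ < L) → Dec (∣ ∁ F ∣ < L) →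
      1 ≤ (light F + light (∁ F)) + (low F + low (∁ F))
    cases _ (yes <L) _       =
      m≤n⇒m≤o+n (light F + light (∁ F)) (m≤n⇒m≤n+o (low (∁ F)) (𝟙-yes (∣ F ∣ <? L) <L))
    cases _ (no _) (yes <L)  =
      m≤n⇒m≤o+n (light F + light (∁ F)) (m≤n⇒m≤o+n (low F) (𝟙-yes (∣ ∁ F ∣ <? L) <L))
    cases f (no ≮L) (no ≮L′) with f (≮⇒≥ ≮L) (≮⇒≥ ≮L′)
    ... | inj₁ l = m≤n⇒m≤n+o (low F + low (∁ F)) (m≤n⇒m≤n+o (light (∁ F)) (𝟙-yes (light? F) l))
    ... | inj₂ l = m≤n⇒m≤n+o (low F + low (∁ F)) (m≤n⇒m≤o+n (light F) (𝟙-yes (light? (∁ F)) l))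

  2*length≤ : 2 * length (members ℱ) ≤ 2 ^ n + 2 * (total light + total low)
  2*length≤ = begin
    2 * length (members ℱ)             ≤⟨ *-monoʳ-≤ 2 (length≤total (unique ℱ)) ⟩
    2 * total member                   ≡⟨ cong (total member +_) (+-identityʳ _) ⟩
    total member + total member        ≡⟨ cong (total member +_) (total-∁ member) ⟨
    total member + total (member ∘ ∁)  ≡⟨ total-+ member (member ∘ ∁) ⟨
    total (λ F → member F + member (∁ F)) ≤⟨ total-mono complementary-pair ⟩
    total (λ F → 1 + ((light F + light (∁ F)) + (low F + low (∁ F))))
      ≡⟨ total-+ (λ _ → 1) (λ F → (light F + light (∁ F)) + (low F + low (∁ F))) ⟩
    total {n} (λ _ → 1) + total (λ F → (light F + light (∁ F)) + (low F + low (∁ F)))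
      ≡⟨ cong₂ _+_ (total-1 n) (total-+ (λ F → light F + light (∁ F)) (λ F → low F + low (∁ F))) ⟩
    2 ^ n + (total (λ F → light F + light (∁ F)) + total (λ F → low F + low (∁ F)))
      ≡⟨ cong (2 ^ n +_) (cong₂ _+_ (paired light) (paired low)) ⟩
    2 ^ n + (2 * total light + 2 * total low)
      ≡⟨ cong (2 ^ n +_) (*-distribˡ-+ 2 (total light) (total low)) ⟨
    2 ^ n + 2 * (total light + total low) ∎
    where
    open ≤-Reasoning
    member : Subset n → ℕ
    member F = 𝟙 (F ∈? members ℱ)
    paired : (f : Subset n → ℕ) → total (λ F → f F + f (∁ F)) ≡ 2 * total f
    paired f = trans (total-+ f (f ∘ ∁)) (cong (total f +_) (trans (total-∁ f) (sym (+-identityʳ _))))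

-- Write K = k+1 and a = 2K. Taking t = s a makes the light sets at most (1 + 1/a) `midBinom`, and
-- the ratio L a makes the low layers at most 1/a of `midBinom`. The two errors add up to 1/K.
upper-bound : (G : Graph) → Bipartite G → 0 < size G → ∀ k n →
  (let a = 2 * suc k ; L = size G + size G * a in (L * a + 1) * L ≤ suc (suc n)) →
  (ℱ : Family (suc n)) → GFree ℱ G →
  suc k * length (members ℱ) ≤ suc k * 2 ^ n + (suc k + 1) * midBinom (suc n)
upper-bound G bip 0<s k n n-large ℱ free = *-cancelˡ-≤ 2 (begin
  2 * (K * length (members ℱ))            ≡⟨ swap₂ K (length (members ℱ)) ⟩
  K * (2 * length (members ℱ))            ≤⟨ *-monoʳ-≤ K (2*length≤ ℱ G bip free 0<s t) ⟩
  K * (2 ^ suc n + 2 * (ℓ + w))           ≡⟨ expand K (2 ^ n) ℓ w ⟩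
  2 * (K * 2 ^ n) + (a * ℓ + a * w)       ≤⟨ +-monoʳ-≤ (2 * (K * 2 ^ n)) (+-mono-≤ aℓ≤ aw≤) ⟩
  2 * (K * 2 ^ n) + ((1 + a) * C + C)     ≡⟨ factor K (2 ^ n) C ⟩
  2 * (K * 2 ^ n + (K + 1) * C)           ∎)
  where
  open ≤-Reasoning
  s K a t L C ℓ w : ℕ
  s = size G
  K = suc k
  a = 2 * K
  t = s * a
  L = s + t
  C = midBinom (suc n)
  ℓ = total (𝟙 ∘ light? ℱ G bip free 0<s t)
  w = total {suc n} (λ F → 𝟙 (∣ F ∣ <? L))
  instance
    _ = >-nonZero 0<s
    _ = >-nonZero (≤-trans 0<s (m≤m+n s t))
  swap₂ : ∀ x y → 2 * (x * y) ≡ x * (2 * y)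
  swap₂ = solve-∀
  expand : ∀ K p x y → K * (2 * p + 2 * (x + y)) ≡ 2 * (K * p) + (2 * K * x + 2 * K * y)
  expand = solve-∀
  factor : ∀ K p c → 2 * (K * p) + ((1 + 2 * K) * c + c) ≡ 2 * (K * p + (K + 1) * c)
  factor = solve-∀
  distribute : ∀ s a c → (s + s * a) * c ≡ s * ((1 + a) * c)
  distribute = solve-∀
  aℓ≤ : a * ℓ ≤ (1 + a) * C
  aℓ≤ = *-cancelˡ-≤ s (begin
    s * (a * ℓ)       ≡⟨ *-assoc s a ℓ ⟨
    t * ℓ             ≤⟨ total-light ℱ G bip free 0<s t ⟩
    (s + t) * C       ≡⟨ distribute s a C ⟩
    s * ((1 + a) * C) ∎)
  aw≤ : a * w ≤ C
  aw≤ = *-cancelˡ-≤ L (begin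
    L * (a * w) ≡⟨ *-assoc L a w ⟨
    L * a * w   ≤⟨ total-lowLayers (suc n) (L * a) L n-large ⟩
    L * C       ∎)

-- Lower bound

disjoint⇒∣A∣+∣B∣≤n : (A B : Subset n) → A ∩ B ≡ ⊥ → ∣ A ∣ + ∣ B ∣ ≤ n
disjoint⇒∣A∣+∣B∣≤n [] [] _ = z≤n
disjoint⇒∣A∣+∣B∣≤n (outside ∷ A) (outside ∷ B) eq = m≤n⇒m≤1+n (disjoint⇒∣A∣+∣B∣≤n A B (∷-injectiveʳ eq))
disjoint⇒∣A∣+∣B∣≤n (outside ∷ A) (inside ∷ B) eq =
  ≤-trans (≤-reflexive (+-suc ∣ A ∣ ∣ B ∣)) (s≤s (disjoint⇒∣A∣+∣B∣≤n A B (∷-injectiveʳ eq)))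
disjoint⇒∣A∣+∣B∣≤n (inside ∷ A) (outside ∷ B) eq = s≤s (disjoint⇒∣A∣+∣B∣≤n A B (∷-injectiveʳ eq))

large-disjoint⇒∁ : (A B : Subset n) → A ∩ B ≡ ⊥ → n ≤ ∣ A ∣ + ∣ B ∣ → B ≡ ∁ A
large-disjoint⇒∁ [] [] _ _ = refl
large-disjoint⇒∁ (outside ∷ A) (outside ∷ B) eq n≤ =
  contradiction (≤-trans n≤ (disjoint⇒∣A∣+∣B∣≤n A B (∷-injectiveʳ eq))) 1+n≰n
large-disjoint⇒∁ (outside ∷ A) (inside ∷ B) eq n≤ = cong (inside ∷_)
  (large-disjoint⇒∁ A B (∷-injectiveʳ eq) (s≤s⁻¹ (≤-trans n≤ (≤-reflexive (+-suc ∣ A ∣ ∣ B ∣)))))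
large-disjoint⇒∁ (inside ∷ A) (outside ∷ B) eq n≤ =
  cong (outside ∷_) (large-disjoint⇒∁ A B (∷-injectiveʳ eq) (s≤s⁻¹ n≤))

headBit : Subset (suc n) → ℕ
headBit F = if head F then 1 else 0

-- For n + 1 odd, the last term keeps half of the layer just below the middle:
-- the sets containing the first element.
Heavy : Subset (suc n) → Set
Heavy {n} F = suc n ≤ 2 * ∣ F ∣ + headBit F

heavy? : Decidable (Heavy {n})
heavy? {n} F = suc n ≤? 2 * ∣ F ∣ + headBit F

-- Only one of two disjoint sets holds the first element, so adding the two conditions leaves an
-- excess of at most 1 over 2(∣ A ∣ + ∣ B ∣). Parity removes it, and the sizes sum to at least n+1.
heavy-disjoint⇒∁ : (A B : Subset (suc n)) → Heavy A → Heavy B → A ∩ B ≡ ⊥ → B ≡ ∁ A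
heavy-disjoint⇒∁ {n} A B hA hB disj =
  large-disjoint⇒∁ A B disj (s≤s⁻¹ (*-cancelˡ-< 2 (suc n) _ (begin-strict
    2 * suc n                                             ≡⟨ cong (suc n +_) (+-identityʳ (suc n)) ⟩
    suc n + suc n                                         ≤⟨ +-mono-≤ hA hB ⟩
    2 * ∣ A ∣ + headBit A + (2 * ∣ B ∣ + headBit B)       ≡⟨ regroup (∣ A ∣) (headBit A) (∣ B ∣) (headBit B) ⟩
    2 * (∣ A ∣ + ∣ B ∣) + (headBit A + headBit B)         ≤⟨ +-monoʳ-≤ (2 * (∣ A ∣ + ∣ B ∣)) (bits A B disj) ⟩
    2 * (∣ A ∣ + ∣ B ∣) + 1                               <⟨ +-monoʳ-< (2 * (∣ A ∣ + ∣ B ∣)) (n<1+n 1) ⟩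
    2 * (∣ A ∣ + ∣ B ∣) + 2                               ≡⟨ shift (∣ A ∣ + ∣ B ∣) ⟩
    2 * suc (∣ A ∣ + ∣ B ∣)                               ∎)))
  where
  open ≤-Reasoning
  regroup : ∀ a b c d → 2 * a + b + (2 * c + d) ≡ 2 * (a + c) + (b + d)
  regroup = solve-∀
  shift : ∀ a → 2 * a + 2 ≡ 2 * suc a
  shift = solve-∀
  bits : (A B : Subset (suc n)) → A ∩ B ≡ ⊥ → headBit A + headBit B ≤ 1
  bits (outside ∷ _) (outside ∷ _) _ = z≤n
  bits (outside ∷ _) (inside ∷ _)  _ = ≤-refl
  bits (inside ∷ _)  (outside ∷ _) _ = ≤-refl

heavyFamily : ∀ n → Family (suc n)
heavyFamily n = family (filter heavy? (supersets ⊥)) (Unique.filter⁺ heavy? (supersets-unique ⊥))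

-- Every neighbour of v must be sent to the complement of `φ v`, so two neighbours contradict
-- injectivity.
heavyFamily-free : ∀ n G → NotMatching G → GFree (heavyFamily n) G
heavyFamily-free n G (v , a , b , a≢b , va , vb) (φ , φ-inj , φ∈ , φ-adj) =
  a≢b (φ-inj (trans (image va) (sym (image vb))))
  where
  heavy : ∀ i → Heavy (φ i)
  heavy i = proj₂ (∈-filter⁻ heavy? {xs = supersets ⊥} (φ∈ i))
  image : ∀ {c} → Adj G v c → φ c ≡ ∁ (φ v)
  image {c} e = heavy-disjoint⇒∁ (φ v) (φ c) (heavy v) (heavy c) (proj₂ (φ-adj v c e))

1+𝟙≤𝟙+𝟙 : {P Q R : Set} (d : Dec P) (e : Dec Q) (f : Dec R) →
  (P → Q) → (P → R) → (¬ Q → R) → 1 + 𝟙 d ≤ 𝟙 e + 𝟙 f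
1+𝟙≤𝟙+𝟙 (yes p) e       f q r ¬q⇒r = +-mono-≤ (𝟙-yes e (q p)) (𝟙-yes f (r p))
1+𝟙≤𝟙+𝟙 (no _)  (yes _) f q r ¬q⇒r = m≤m+n 1 _
1+𝟙≤𝟙+𝟙 (no _)  (no ¬q) f q r ¬q⇒r = 𝟙-yes f (¬q⇒r ¬q)

-- The sets F ⊆ [n] index the complementary pairs `outside ∷ F`, `inside ∷ ∁ F`. At least one of
-- each pair is heavy, which gives 2^n, and both are when ∣ F ∣ = h+1, which gives the binomial.
length-heavyFamily : ∀ {n} m h → m + h ≡ n → h ≤ m → m ≤ suc h →
  2 ^ n + n C suc h ≤ length (members (heavyFamily n))
length-heavyFamily {n} m h m+h≡n h≤m m≤1+h = begin
  2 ^ n + n C suc h                                        ≡⟨ cong₂ _+_ (total-1 n) (total-layer n (suc h)) ⟨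
  total {n} (λ _ → 1) + total {n} (λ F → 𝟙 (∣ F ∣ ≟ suc h)) ≡⟨ total-+ {n} (λ _ → 1) (λ F → 𝟙 (∣ F ∣ ≟ suc h)) ⟨
  total {n} (λ F → 1 + 𝟙 (∣ F ∣ ≟ suc h))                  ≤⟨ total-mono {n} pointwise ⟩
  total (λ F → with1 (∁ F) + with0 F)                      ≡⟨ total-+ (with1 ∘ ∁) with0 ⟩
  total (with1 ∘ ∁) + total with0                          ≡⟨ cong (_+ total with0) (total-∁ with1) ⟩
  total with1 + total with0                                ≡⟨ length-filter-supersets {suc n} heavy? ⊥ ⟨
  length (members (heavyFamily n))                         ∎
  where
  open ≤-Reasoning
  with1 with0 : Subset n → ℕ
  with1 F = 𝟙 (heavy? (inside ∷ F))
  with0 F = 𝟙 (heavy? (outside ∷ F))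

  half : ∀ {g c} → g + c ≡ n → g ≡ suc h → suc c ≡ m
  half {c = c} g+c≡n refl = +-cancelˡ-≡ h _ _ (trans (+-suc h c) (trans g+c≡n (trans (sym m+h≡n) (+-comm m h))))

  pointwise : ∀ F → 1 + 𝟙 (∣ F ∣ ≟ suc h) ≤ with1 (∁ F) + with0 F
  pointwise F = 1+𝟙≤𝟙+𝟙 (∣ F ∣ ≟ suc h) (heavy? (inside ∷ ∁ F)) (heavy? (outside ∷ F)) at-h₁ at-h₀ otherwise
    where
    g+c≡n = ∣p∣+∣∁p∣≡n F
    at-h₁ : ∣ F ∣ ≡ suc h → Heavy (inside ∷ ∁ F)
    at-h₁ eq = begin
      suc n                    ≡⟨ cong suc m+h≡n ⟨
      suc (m + h)              ≤⟨ s≤s (+-monoʳ-≤ m h≤m) ⟩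
      suc (m + m)              ≡⟨ lemma m ⟩
      2 * m + 1                ≡⟨ cong (λ x → 2 * x + 1) (half g+c≡n eq) ⟨
      2 * suc ∣ ∁ F ∣ + 1      ∎
      where
      lemma : ∀ m → suc (m + m) ≡ 2 * m + 1
      lemma = solve-∀
    at-h₀ : ∣ F ∣ ≡ suc h → Heavy (outside ∷ F)
    at-h₀ eq = begin
      suc n           ≡⟨ cong suc m+h≡n ⟨
      suc (m + h)     ≤⟨ s≤s (+-monoˡ-≤ h m≤1+h) ⟩
      suc (suc h + h) ≡⟨ lemma h ⟩
      2 * suc h + 0   ≡⟨ cong (λ x → 2 * x + 0) eq ⟨
      2 * ∣ F ∣ + 0   ∎
      where
      lemma : ∀ h → suc (suc h + h) ≡ 2 * suc h + 0
      lemma = solve-∀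
    otherwise : ¬ Heavy (inside ∷ ∁ F) → Heavy (outside ∷ F)
    otherwise ¬heavy = begin
      suc n                   ≡⟨ cong suc g+c≡n ⟨
      suc (∣ F ∣ + ∣ ∁ F ∣)   ≡⟨ +-suc ∣ F ∣ ∣ ∁ F ∣ ⟨
      ∣ F ∣ + suc ∣ ∁ F ∣     ≤⟨ +-monoʳ-≤ ∣ F ∣ (<⇒≤ c+1<g) ⟩
      ∣ F ∣ + ∣ F ∣           ≡⟨ lemma ∣ F ∣ ⟩
      2 * ∣ F ∣ + 0           ∎
      where
      lemma : ∀ g → g + g ≡ 2 * g + 0
      lemma = solve-∀
      expand : ∀ c → 2 * suc c + 1 ≡ suc (suc (suc c)) + c
      expand = solve-∀
      c+1<g : suc ∣ ∁ F ∣ < ∣ F ∣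
      c+1<g = +-cancelʳ-≤ ∣ ∁ F ∣ _ _ (s≤s⁻¹ (begin
        suc (suc (suc ∣ ∁ F ∣) + ∣ ∁ F ∣) ≤⟨ n≤1+n _ ⟩
        suc (suc (suc (suc ∣ ∁ F ∣)) + ∣ ∁ F ∣) ≡⟨ cong suc (expand ∣ ∁ F ∣) ⟨
        suc (2 * suc ∣ ∁ F ∣ + 1)         ≤⟨ ≰⇒> ¬heavy ⟩
        suc n                             ≡⟨ cong suc g+c≡n ⟨
        suc (∣ F ∣ + ∣ ∁ F ∣)             ∎))

-- Reflection moves the middle index m to h+1, then Pascal's rule applies. The summand `n C suc h`
-- is the surplus of `heavyFamily`, and the two summands are nearly equal: this is the source of the
-- factor 1/2.
midBinom-split : ∀ n → ∃ λ m → ∃ λ h → m + h ≡ n × h ≤ m × m ≤ suc h × midBinom (suc n) ≡ n C h + n C suc h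
midBinom-split n = m , h , suc-injective (trans (sym (+-suc m h)) m+1+h≡1+n) , s≤s⁻¹ 1+h≤1+m , m≤1+h ,
    trans (trans (nCk≡nC[n∸k] m≤1+n) (cong (suc n C_) (sym 1+h≡))) (sym (nCk+nC[k+1]≡[n+1]C[k+1] n h))
  where
  open ≤-Reasoning
  m = suc n / 2
  m≤n : m ≤ n
  m≤n = s≤s⁻¹ (m/n<m (suc n) 2 ≤-refl)
  m≤1+n : m ≤ suc n
  m≤1+n = m≤n⇒m≤1+n m≤n
  h = n ∸ m
  1+h≡ : suc h ≡ suc n ∸ m
  1+h≡ = sym (+-∸-assoc 1 m≤n)
  m+1+h≡1+n : m + suc h ≡ suc n
  m+1+h≡1+n = trans (cong (m +_) 1+h≡) (m+[n∸m]≡n m≤1+n)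
  1+h≤1+m : suc h ≤ suc m
  1+h≤1+m = +-cancelˡ-≤ m _ _ (begin
    m + suc h     ≡⟨ m+1+h≡1+n ⟩
    suc n         ≤⟨ n≤1+2*[n/2] (suc n) ⟩
    suc (2 * m)   ≡⟨ lemma m ⟩
    m + suc m     ∎)
    where
    lemma : ∀ m → suc (2 * m) ≡ m + suc m
    lemma = solve-∀
  m≤1+h : m ≤ suc h
  m≤1+h = +-cancelˡ-≤ m _ _ (begin
    m + m     ≡⟨ cong (m +_) (+-identityʳ m) ⟨
    2 * m     ≤⟨ 2*[n/2]≤n (suc n) ⟩
    suc n     ≡⟨ m+1+h≡1+n ⟨
    m + suc h ∎)

-- The hypothesis is H(a-b) ≤ a, which weakens to any smaller K when a ≥ b and is trivial otherwise.
K*a≤K*b+a : ∀ {K H} a b → K ≤ H → H * a ≤ H * b + a → K * a ≤ K * b + a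
K*a≤K*b+a {K} {H} a b K≤H Ha≤ with ≤-total a b
... | inj₁ a≤b = ≤-trans (*-monoʳ-≤ K a≤b) (m≤m+n _ _)
... | inj₂ b≤a = begin
  K * a               ≡⟨ split K ⟨
  K * b + K * (a ∸ b) ≤⟨ +-monoʳ-≤ (K * b) (*-monoˡ-≤ (a ∸ b) K≤H) ⟩
  K * b + H * (a ∸ b) ≤⟨ +-monoʳ-≤ (K * b) (+-cancelˡ-≤ (H * b) _ _ (≤-trans (≤-reflexive (split H)) Ha≤)) ⟩
  K * b + a           ∎
  where
  open ≤-Reasoning
  split : ∀ K → K * b + K * (a ∸ b) ≡ K * a
  split K = trans (sym (*-distribˡ-+ K b (a ∸ b))) (cong (K *_) (m+[n∸m]≡n b≤a))

-- Absorption gives (h+1) C(n,h+1) = m C(n,h), and m ≥ h.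
central-ratio : ∀ {n} m h → m + h ≡ n → h ≤ m → suc h * (n C h) ≤ suc h * (n C suc h) + n C h
central-ratio m h refl h≤m = +-cancelʳ-≤ (h * a) _ _ (begin
  suc h * a + h * a       ≡⟨ *-distribʳ-+ a (suc h) h ⟨
  suc (h + h) * a         ≤⟨ *-monoˡ-≤ a (s≤s (+-monoˡ-≤ h h≤m)) ⟩
  suc (m + h) * a         ≡⟨ C-absorption (m + h) h ⟨
  suc h * b + (a + h * a) ≡⟨ +-assoc (suc h * b) a (h * a) ⟨
  suc h * b + a + h * a   ∎)
  where
  open ≤-Reasoning
  a = (m + h) C h
  b = (m + h) C suc h

lower-bound : ∀ k n → 2 * k ≤ n →
  let v = length (members (heavyFamily n)) in
  2 * suc k * 2 ^ n + suc k * midBinom (suc n) ≤ 2 * suc k * v + 2 * midBinom (suc n)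
lower-bound k n 2k≤n with m , h , m+h≡n , h≤m , m≤1+h , mid≡ ← midBinom-split n = begin
  2 * K * p + K * midBinom (suc n)          ≡⟨ cong (λ x → 2 * K * p + K * x) mid≡ ⟩
  2 * K * p + K * (a + b)                   ≡⟨ expand K p a b ⟩
  2 * K * p + K * b + K * a                 ≤⟨ +-monoʳ-≤ (2 * K * p + K * b) (K*a≤K*b+a a b (s≤s k≤h) (central-ratio m h m+h≡n h≤m)) ⟩
  -- The padding `a + 2 * b` raises the error `a` to the permitted 2(a + b) = 2 `midBinom (suc n)`.
  2 * K * p + K * b + (K * b + a)           ≤⟨ m≤m+n _ (a + 2 * b) ⟩
  2 * K * p + K * b + (K * b + a) + (a + 2 * b) ≡⟨ collect K p a b ⟩
  2 * K * (p + b) + 2 * (a + b)             ≤⟨ +-mono-≤ (*-monoʳ-≤ (2 * K) (length-heavyFamily m h m+h≡n h≤m m≤1+h)) (≤-reflexive (cong (2 *_) (sym mid≡))) ⟩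
  2 * K * length (members (heavyFamily n)) + 2 * midBinom (suc n) ∎
  where
  open ≤-Reasoning
  K = suc k
  p = 2 ^ n
  a = n C h
  b = n C suc h
  k≤h : k ≤ h
  k≤h = s≤s⁻¹ (*-cancelˡ-< 2 k (suc h) (begin-strict
    2 * k             ≤⟨ 2k≤n ⟩
    n                 ≡⟨ m+h≡n ⟨
    m + h             ≤⟨ +-monoˡ-≤ h m≤1+h ⟩
    suc h + h         <⟨ +-monoʳ-< (suc h) (n<1+n h) ⟩
    suc h + suc h     ≡⟨ cong (suc h +_) (+-identityʳ (suc h)) ⟨
    2 * suc h         ∎))
  expand : ∀ K p a b → 2 * K * p + K * (a + b) ≡ 2 * K * p + K * b + K * a
  expand = solve-∀
  collect : ∀ K p a b → 2 * K * p + K * b + (K * b + a) + (a + 2 * b) ≡ 2 * K * (p + b) + 2 * (a + b)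
  collect = solve-∀

-- Both bounds for all large n

*≤⇒≤/ : ∀ K m x → suc K * m ≤ x → m ≤ x / suc K
*≤⇒≤/ K m x le = begin
  m                 ≡⟨ m*n/n≡m m (suc K) ⟨
  m * suc K / suc K ≤⟨ /-monoˡ-≤ (suc K) (≤-trans (≤-reflexive (*-comm m (suc K))) le) ⟩
  x / suc K         ∎
  where open ≤-Reasoning

-- Here 1/(k+1) is the arbitrary ε behind o(1), with denominators cleared: the binomial has
-- coefficient 1/2 - 1/(k+1) in the lower bound and 1 + 1/(k+1) in the upper one.
theorem2 : (G : Graph) → Bipartite G → NotMatching G →
    (k : ℕ) → ∃ λ N → (n : ℕ) → N ≤ n →
    (∃ λ v → VexAtLeast n G v × 2 * suc k * 2 ^ (n ∸ 1) + suc k * midBinom n ≤ 2 * suc k * v + 2 * midBinom n)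
    × (∃ λ v → VexAtMost n G v × suc k * v ≤ suc k * 2 ^ (n ∸ 1) + (suc k + 1) * midBinom n)
-- The summand 2k serves the lower bound and the other one the low layers; the outer `suc` makes n
-- positive, so that a first element exists.
theorem2 G bip nm k = suc (2 * k + (L * a + 1) * L) , bounds
  where
  a = 2 * suc k
  L = size G + size G * a
  0<s : 0 < size G
  0<s = ≤-trans (s≤s z≤n) (Fin.toℕ<n (proj₁ nm))
  bounds : (n : ℕ) → suc (2 * k + (L * a + 1) * L) ≤ n → _
  bounds (suc n) (s≤s N≤n) =
    (length (members (heavyFamily n)) ,
      (heavyFamily n , heavyFamily-free n G nm , ≤-refl) ,
      lower-bound k n (≤-trans (m≤m+n _ _) N≤n)) ,
    -- Family sizes are integers, so the bound may be rounded down.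
    (X / suc k ,
      (λ ℱ free → *≤⇒≤/ k _ X (upper-bound G bip 0<s k n
        (≤-trans (m≤n+m _ (2 * k)) (≤-trans N≤n (≤-trans (n≤1+n n) (n≤1+n (suc n))))) ℱ free)) ,
      ≤-trans (≤-reflexive (*-comm (suc k) (X / suc k))) (m/n*n≤m X (suc k)))
    where
    X = suc k * 2 ^ n + (suc k + 1) * midBinom (suc n)
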